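{- Let $k\ge 1$ and let $F=\bigcup_{i=1}^{k}S_{d_i}$ be a star forest with $d_1\ge d_2\ge\cdots\ge d_k\ge 1$. Let $m\ge k-1$ be a positive integer. For $n$ sufficiently large compared to $m$ and $d_1,\dots,d_k$ (i.e. for all $n\ge n_0(m,d_1,\dots,d_k)$), $$\mathrm{ex}(m,n;F)=(k-1)\,n+(d_k-1)(m-k+1).$$ Moreover, the unique extremal graph is $\mathcal{B}(m,n;k)$; that is, every $F$-free bipartite graph $G=(A,B;E)$ with $|A|=m$, $|B|=n$ and $e(G)=\mathrm{ex}(m,n;F)$ is of the form $\mathcal{B}(m,n;k)$.
   Context: All graphs are finite, simple and undirected, and $e(G)$ denotes the number of edges of $G$. For a graph $H$ and positive integers $m\le n$, $\mathrm{ex}(m,n;H)$ is the maximum number of edges in an $H$-free bipartite graph $G=(A,B;E)$ with parts $A,B$ of sizes $|A|=m$ and $|B|=n$. Here "$H$-free" means that $G$ contains no (not necessarily induced) subgraph isomorphic to $H$; a copy of $H$ may be placed in $G$ in any way with respect to the parts $A,B$. $S_d$ denotes the star with one center and $d$ leaves, and $\bigcup_{i=1}^k S_{d_i}$ is the vertex-disjoint union of the stars $S_{d_1},\dots,S_{d_k}$. The graph $\mathcal{B}(m,n;k)$ is the bipartite graph with parts $A,B$, $|A|=m$, $|B|=n$, obtained by taking $k-1$ vertices of $A$ each adjacent to all of $B$, and letting each of the remaining $m-k+1$ vertices of $A$ have degree exactly $d_k-1$ into $B$. -}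

module Defs where

open import Data.Bool using (Bool; true; T)
open import Data.Empty using (⊥)
open import Data.Fin using (Fin; zero; suc)
open import Data.Fin.Properties using (+↔⊎)
open import Data.Fin.Subset using (Subset; _∈_; _∉_; ∣_∣)
open import Data.List using (length; filterᵇ; allFin; cartesianProduct)
open import Data.Nat using (ℕ; zero; suc; _+_; _∸_; _≤_)
open import Data.Product using (Σ; ∃; _×_; _,_; uncurry)
open import Data.Sum using (_⊎_; inj₁; inj₂)
open import Data.Sum.Function.Propositional using (_⊎-↔_)
open import Data.Vec.Functional using (Vector)
open import Function.Base using (_∘_)
open import Function.Bundles using (_↔_; _↣_; mk↔ₛ′; module Injection)
open import Function.Construct.Composition using (_↔-∘_)
open import Function.Construct.Identity using (↔-id)
open import Level using (0ℓ)
open import Relation.Binary.Core using (Rel)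
open import Relation.Binary.Definitions using (Irreflexive; Symmetric)
open import Relation.Binary.PropositionalEquality using (_≡_; refl)
open import Relation.Nullary using (¬_)

record Graph : Set₁ where
  field
    Vertex : Set
    _~_    : Rel Vertex 0ℓ
    ~-sym  : Symmetric _~_
    irrefl : Irreflexive _≡_ _~_
    order  : ℕ
    finite : Fin order ↔ Vertex

-- A copy of H in G is a not necessarily induced subgraph, so adjacency
-- has to be preserved but need not be reflected.
Copy : Graph → Graph → Set
Copy H G =
  Σ (Vertex H ↣ Vertex G) λ f →
    ∀ {x y} → _~_ H x y → _~_ G (Injection.to f x) (Injection.to f y)
  where open Graph

_-free_ : Graph → Graph → Set
H -free G = ¬ Copy H G

-- The centre of the star is vertex zero.
data StarAdj {d : ℕ} : Rel (Fin (suc d)) 0ℓ where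
  centre-leaf : (i : Fin d) → StarAdj zero (suc i)
  leaf-centre : (i : Fin d) → StarAdj (suc i) zero

star : ℕ → Graph
star d = record
  { Vertex = Fin (suc d)
  ; _~_    = StarAdj
  ; ~-sym  = λ { (centre-leaf i) → leaf-centre i ; (leaf-centre i) → centre-leaf i }
  ; irrefl = λ { refl () }
  ; order  = suc d
  ; finite = ↔-id _
  }

data ⨆Adj {k : ℕ} (G : Vector Graph k) : Rel (Σ (Fin k) (Graph.Vertex ∘ G)) 0ℓ where
  within : ∀ i {x y} → Graph._~_ (G i) x y → ⨆Adj G (i , x) (i , y)

⨆order : ∀ {k} → Vector Graph k → ℕ
⨆order {zero}  G = 0
⨆order {suc k} G = Graph.order (G zero) + ⨆order (G ∘ suc)

⊎↔Σ : ∀ {k} (P : Fin (suc k) → Set) → (P zero ⊎ Σ (Fin k) (P ∘ suc)) ↔ Σ (Fin (suc k)) P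
⊎↔Σ P = mk↔ₛ′
  (λ { (inj₁ x) → zero , x ; (inj₂ (i , x)) → suc i , x })
  (λ { (zero , x) → inj₁ x ; (suc i , x) → inj₂ (i , x) })
  (λ { (zero , x) → refl ; (suc i , x) → refl })
  (λ { (inj₁ x) → refl ; (inj₂ (i , x)) → refl })

⨆finite : ∀ {k} (G : Vector Graph k) → Fin (⨆order G) ↔ Σ (Fin k) (Graph.Vertex ∘ G)
⨆finite {zero}  G = mk↔ₛ′ (λ ()) (λ ()) (λ ()) (λ ())
⨆finite {suc k} G =
  ⊎↔Σ (Graph.Vertex ∘ G) ↔-∘ ((Graph.finite (G zero) ⊎-↔ ⨆finite (G ∘ suc)) ↔-∘ +↔⊎)

⨆ : ∀ {k} → Vector Graph k → Graph
⨆ {k} G = record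
  { Vertex = Σ (Fin k) (Graph.Vertex ∘ G)
  ; _~_    = ⨆Adj G
  ; ~-sym  = λ { (within i e) → within i (Graph.~-sym (G i) e) }
  ; irrefl = λ { refl (within i e) → Graph.irrefl (G i) refl e }
  ; order  = ⨆order G
  ; finite = ⨆finite G
  }

starForest : ∀ {k} → Vector ℕ k → Graph
starForest d = ⨆ (star ∘ d)

-- A bipartite graph with parts A = Fin m and B = Fin n, given by its
-- biadjacency matrix.
BipartiteGraph : ℕ → ℕ → Set
BipartiteGraph m n = Fin m → Fin n → Bool

module _ {m n : ℕ} (G : BipartiteGraph m n) where

  BipAdj : Rel (Fin m ⊎ Fin n) 0ℓ
  BipAdj (inj₁ a) (inj₁ a′) = ⊥
  BipAdj (inj₁ a) (inj₂ b)  = T (G a b)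
  BipAdj (inj₂ b) (inj₁ a)  = T (G a b)
  BipAdj (inj₂ b) (inj₂ b′) = ⊥

  BipAdj-sym : Symmetric BipAdj
  BipAdj-sym {inj₁ a} {inj₂ b} e = e
  BipAdj-sym {inj₂ b} {inj₁ a} e = e

  BipAdj-irrefl : Irreflexive _≡_ BipAdj
  BipAdj-irrefl {inj₁ a} refl ()
  BipAdj-irrefl {inj₂ b} refl ()

  toGraph : Graph
  toGraph = record
    { Vertex = Fin m ⊎ Fin n
    ; _~_    = BipAdj
    ; ~-sym  = λ {x} {y} → BipAdj-sym {x} {y}
    ; irrefl = BipAdj-irrefl
    ; order  = m + n
    ; finite = +↔⊎
    }

  -- Each edge has exactly one end in A and one in B, so it is counted once.
  e : ℕ
  e = length (filterᵇ (uncurry G) (cartesianProduct (allFin m) (allFin n)))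

  degᴬ : Fin m → ℕ
  degᴬ a = length (filterᵇ (G a) (allFin n))

-- N = ex(m,n;H).  The maximum is expressed as a relation, which determines N.
IsEx : ℕ → ℕ → Graph → ℕ → Set
IsEx m n H N =
    (∃ λ (G : BipartiteGraph m n) → H -free toGraph G × e G ≡ N)
  × (∀ (G : BipartiteGraph m n) → H -free toGraph G → e G ≤ N)

-- G is of the form 𝓑(m,n;k), where dₖ is the size of the smallest star.
-- S is the set of k ∸ 1 vertices joined to all of B.  How the remaining edges
-- are distributed over B is left free, so this describes a family of graphs.
Is𝓑 : ∀ {m n} (k dₖ : ℕ) → BipartiteGraph m n → Set
Is𝓑 {m} k dₖ G = ∃ λ (S : Subset m) →
    ∣ S ∣ ≡ k ∸ 1
  × (∀ a → a ∈ S → ∀ b → G a b ≡ true)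
  × (∀ a → a ∉ S → degᴬ G a ≡ dₖ ∸ 1)

{-# OPTIONS --safe #-}

-- If k − 1 vertices of A have degree at least d₁ + ⋯ + dₖ and some further
-- vertex a of A has degree at least dₖ, then the forest embeds greedily with
-- all its centres in A: the leaves at a are chosen first, and the large
-- degrees leave room for the other stars.  For large n, a graph with at least
-- (k − 1)n edges has k − 1 such vertices, so if it is free of the forest then
-- every other vertex of A has degree at most dₖ − 1, and summing degrees gives
-- the bound together with its equality case.  The bound is attained when
-- the neighbourhoods of the other vertices are pairwise disjoint, since then
-- every star of size at least dₖ uses one of the k − 1 full vertices.
module Submission where

open import Defs
import Algebra.Properties.CommutativeMonoid.Sum
open import Data.Bool using (Bool; true; false; T; _∧_; _∨_; if_then_else_)
open import Data.Bool.Properties using (T-≡; T-∧; T-∨; T?)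
open import Data.Fin using (Fin; zero; suc; toℕ; fromℕ; fromℕ<; inject₁) renaming (_≤_ to _≤ᶠ_)
open import Data.Fin.Properties using (toℕ<n; toℕ-injective; suc-injective; pigeonhole; fromℕ<-injective; ≤fromℕ; <⇒≢)
open import Data.Fin.Relation.Unary.Top using (View; view; ‵fromℕ; ‵inject₁)
open import Data.Fin.Subset using (Subset; inside; outside; _∈_; _∉_; _⊆_; ∣_∣; ∁; ⊤; ⊥; _∪_; _─_)
open import Data.Fin.Subset.Properties using (∣p∣≤n; ∣⊤∣≡n; ∣⊥∣≡0; ∣p∣≡n⇒p≡⊤; ∣∁p∣≡n∸∣p∣; _∈?_; ∈⊤; ∉⊥; p⊆q⇒∣p∣≤∣q∣; out⊆; in⊆in; p─q⊆p; p⊆p∪q; q⊆p∪q)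
open import Data.List using (List; []; _∷_; _++_; length; filterᵇ; allFin; cartesianProduct; map; tabulate)
open import Data.List.Properties using (length-++; filter-++)
open import Data.Nat using (ℕ; zero; suc; _+_; _*_; _∸_; _≤_; _<_; _≥_; z≤n; s≤s; _≤ᵇ_; _<ᵇ_; _≤?_; _<?_)
open import Data.Nat.Properties hiding (suc-injective; <⇒≢)
open import Data.Product using (∃; Σ; _×_; _,_; proj₁; proj₂; uncurry)
open import Data.Sum using (_⊎_; inj₁; inj₂; [_,_]′)
open import Data.Sum.Properties using (inj₁-injective; inj₂-injective)
open import Data.Vec as Vec using ([]; _∷_; here; there; lookup)
open import Data.Vec.Functional using (Vector; last)
open import Data.Vec.Properties using ([]=⇒lookup; lookup⇒[]=; lookup∘tabulate; tabulate-cong)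
open import Function using (_∘_; id; Injective)
open import Function.Bundles using (mk↣; module Injection; module Equivalence)
open import Relation.Binary.Core using (_Preserves_⟶_)
open import Relation.Binary.PropositionalEquality
open import Relation.Nullary using (yes; no; contradiction)

open Algebra.Properties.CommutativeMonoid.Sum +-0-commutativeMonoid using (sum; sum-cong-≗)

-- Finite sums and subsets

sum-mono-≤ : ∀ {m} {f g : Vector ℕ m} → (∀ i → f i ≤ g i) → sum f ≤ sum g
sum-mono-≤ {zero}  f≤g = z≤n
sum-mono-≤ {suc m} f≤g = +-mono-≤ (f≤g zero) (sum-mono-≤ (f≤g ∘ suc))

-- A deficit in one term could only be made up by an excess in another, which the termwise bound
-- rules out. This is the source of the equality case.
≤∧sum-≥⇒≗ : ∀ {m} {f g : Vector ℕ m} → (∀ i → f i ≤ g i) → sum g ≤ sum f → f ≗ g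
≤∧sum-≥⇒≗ {suc m} {f} {g} f≤g Σg≤Σf zero = ≤-antisym (f≤g zero)
  (+-cancelʳ-≤ _ _ _ (≤-trans Σg≤Σf (+-monoʳ-≤ (f zero) (sum-mono-≤ (f≤g ∘ suc)))))
≤∧sum-≥⇒≗ {suc m} {f} {g} f≤g Σg≤Σf (suc i) = ≤∧sum-≥⇒≗ (f≤g ∘ suc)
  (+-cancelˡ-≤ _ _ _ (≤-trans Σg≤Σf (+-monoˡ-≤ _ (f≤g zero)))) i

lookup≤sum : ∀ {k} (d : Vector ℕ k) i → d i ≤ sum d
lookup≤sum d zero    = m≤m+n _ _
lookup≤sum d (suc i) = ≤-trans (lookup≤sum (d ∘ suc) i) (m≤n+m _ _)

∈-tabulate⁻ : ∀ {n} (p : Fin n → Bool) {x} → x ∈ Vec.tabulate p → p x ≡ true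
∈-tabulate⁻ p {x} x∈ = trans (sym (lookup∘tabulate p x)) ([]=⇒lookup x∈)

∈-tabulate⁺ : ∀ {n} (p : Fin n → Bool) {x} → p x ≡ true → x ∈ Vec.tabulate p
∈-tabulate⁺ p {x} px = lookup⇒[]= x _ (trans (lookup∘tabulate p x) px)

length-filterᵇ-tabulate : ∀ {A : Set} (p : A → Bool) {n} (f : Fin n → A) →
  length (filterᵇ p (tabulate f)) ≡ ∣ Vec.tabulate (p ∘ f) ∣
length-filterᵇ-tabulate p {zero}  f = refl
length-filterᵇ-tabulate p {suc n} f with p (f zero)
... | true  = cong suc (length-filterᵇ-tabulate p (f ∘ suc))
... | false = length-filterᵇ-tabulate p (f ∘ suc)

length-filterᵇ-map : ∀ {A B : Set} (p : B → Bool) (f : A → B) xs →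
  length (filterᵇ p (map f xs)) ≡ length (filterᵇ (p ∘ f) xs)
length-filterᵇ-map p f []       = refl
length-filterᵇ-map p f (x ∷ xs) with p (f x)
... | true  = cong suc (length-filterᵇ-map p f xs)
... | false = length-filterᵇ-map p f xs

⊆-choose : ∀ {n k} (p : Subset n) → k ≤ ∣ p ∣ → ∃ λ q → q ⊆ p × ∣ q ∣ ≡ k
⊆-choose {n} {zero} p k≤ = ⊥ , (λ x∈⊥ → contradiction x∈⊥ ∉⊥) , ∣⊥∣≡0 n
⊆-choose {k = suc k} (inside ∷ p) (s≤s k≤) =
  let q , q⊆p , ∣q∣≡k = ⊆-choose p k≤ in inside ∷ q , in⊆in q⊆p , cong suc ∣q∣≡k
⊆-choose {k = suc k} (outside ∷ p) k≤ =
  let q , q⊆p , ∣q∣≡k = ⊆-choose p k≤ in outside ∷ q , out⊆ q⊆p , ∣q∣≡k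

elements : ∀ {n} (p : Subset n) → Vector (Fin n) ∣ p ∣
elements (inside  ∷ p) zero    = zero
elements (inside  ∷ p) (suc i) = suc (elements p i)
elements (outside ∷ p) i       = suc (elements p i)

elements-∈ : ∀ {n} (p : Subset n) i → elements p i ∈ p
elements-∈ (inside  ∷ p) zero    = here
elements-∈ (inside  ∷ p) (suc i) = there (elements-∈ p i)
elements-∈ (outside ∷ p) i       = there (elements-∈ p i)

elements-injective : ∀ {n} (p : Subset n) → Injective _≡_ _≡_ (elements p)
elements-injective (inside  ∷ p) {zero}  {zero}  eq = refl
elements-injective (inside  ∷ p) {suc i} {suc j} eq =
  cong suc (elements-injective p (suc-injective eq))
elements-injective (outside ∷ p) eq = elements-injective p (suc-injective eq)

enumerate : ∀ {n k} (p : Subset n) → ∣ p ∣ ≡ k →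
  ∃ λ (f : Vector (Fin n) k) → Injective _≡_ _≡_ f × (∀ i → f i ∈ p)
enumerate p refl = elements p , elements-injective p , elements-∈ p

∣p∣≤∣p─q∣+∣q∣ : ∀ {n} (p q : Subset n) → ∣ p ∣ ≤ ∣ p ─ q ∣ + ∣ q ∣
∣p∣≤∣p─q∣+∣q∣ []            []            = z≤n
∣p∣≤∣p─q∣+∣q∣ (inside  ∷ p) (inside  ∷ q) =
  subst (suc ∣ p ∣ ≤_) (sym (+-suc _ _)) (s≤s (∣p∣≤∣p─q∣+∣q∣ p q))
∣p∣≤∣p─q∣+∣q∣ (inside  ∷ p) (outside ∷ q) = s≤s (∣p∣≤∣p─q∣+∣q∣ p q)
∣p∣≤∣p─q∣+∣q∣ (outside ∷ p) (inside  ∷ q) =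
  ≤-trans (∣p∣≤∣p─q∣+∣q∣ p q) (+-monoʳ-≤ ∣ p ─ q ∣ (n≤1+n _))
∣p∣≤∣p─q∣+∣q∣ (outside ∷ p) (outside ∷ q) = ∣p∣≤∣p─q∣+∣q∣ p q

∣p∪q∣≤∣p∣+∣q∣ : ∀ {n} (p q : Subset n) → ∣ p ∪ q ∣ ≤ ∣ p ∣ + ∣ q ∣
∣p∪q∣≤∣p∣+∣q∣ []            []            = z≤n
∣p∪q∣≤∣p∣+∣q∣ (inside  ∷ p) (inside  ∷ q) =
  s≤s (≤-trans (∣p∪q∣≤∣p∣+∣q∣ p q) (+-monoʳ-≤ ∣ p ∣ (n≤1+n _)))
∣p∪q∣≤∣p∣+∣q∣ (inside  ∷ p) (outside ∷ q) = s≤s (∣p∪q∣≤∣p∣+∣q∣ p q)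
∣p∪q∣≤∣p∣+∣q∣ (outside ∷ p) (inside  ∷ q) =
  subst (suc ∣ p ∪ q ∣ ≤_) (sym (+-suc _ _)) (s≤s (∣p∪q∣≤∣p∣+∣q∣ p q))
∣p∪q∣≤∣p∣+∣q∣ (outside ∷ p) (outside ∷ q) = ∣p∪q∣≤∣p∣+∣q∣ p q

p─q-disjoint-q : ∀ {n} (p q : Subset n) {x} → x ∈ p ─ q → x ∉ q
p─q-disjoint-q (inside  ∷ p) (outside ∷ q) here       ()
p─q-disjoint-q (_       ∷ p) (_       ∷ q) (there x∈) (there x∈q) = p─q-disjoint-q p q x∈ x∈q

-- Two-valued degree sequences

module _ {m : ℕ} (S : Subset m) (x y : ℕ) where

  -- With `x = n` and `y = last d ∸ 1` these are the degrees in A of a graph of the form 𝓑 whose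
  -- full vertices are `S`.
  weight : Vector ℕ m
  weight a = if lookup S a then x else y

  weight-∈ : ∀ {a} → a ∈ S → weight a ≡ x
  weight-∈ a∈S rewrite []=⇒lookup a∈S = refl

  weight-∉ : ∀ {a} → a ∉ S → weight a ≡ y
  weight-∉ {a} a∉S with lookup S a in eq
  ... | true  = contradiction (lookup⇒[]= a S eq) a∉S
  ... | false = refl

  ≤-weight : {f : Vector ℕ m} → (∀ a → a ∈ S → f a ≤ x) → (∀ a → a ∉ S → f a ≤ y) →
    ∀ a → f a ≤ weight a
  ≤-weight ∈⇒≤ ∉⇒≤ a with a ∈? S
  ... | yes a∈S = ≤-trans (∈⇒≤ a a∈S) (≤-reflexive (sym (weight-∈ a∈S)))
  ... | no  a∉S = ≤-trans (∉⇒≤ a a∉S) (≤-reflexive (sym (weight-∉ a∉S)))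

-- Counting the complement directly keeps truncated subtraction out of the induction.
sum-weight-∁ : ∀ {m} (S : Subset m) x y → sum (weight S x y) ≡ ∣ S ∣ * x + y * ∣ ∁ S ∣
sum-weight-∁ []            x y = sym (*-zeroʳ y)
sum-weight-∁ (inside  ∷ S) x y =
  trans (cong (x +_) (sum-weight-∁ S x y)) (sym (+-assoc x (∣ S ∣ * x) _))
sum-weight-∁ (outside ∷ S) x y = begin
  y + sum (weight S x y)            ≡⟨ cong (y +_) (sum-weight-∁ S x y) ⟩
  y + (∣ S ∣ * x + y * ∣ ∁ S ∣)     ≡⟨ sym (+-assoc y _ _) ⟩
  y + ∣ S ∣ * x + y * ∣ ∁ S ∣       ≡⟨ cong (_+ y * ∣ ∁ S ∣) (+-comm y _) ⟩
  ∣ S ∣ * x + y + y * ∣ ∁ S ∣       ≡⟨ +-assoc (∣ S ∣ * x) y _ ⟩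
  ∣ S ∣ * x + (y + y * ∣ ∁ S ∣)     ≡⟨ cong (∣ S ∣ * x +_) (sym (*-suc y _)) ⟩
  ∣ S ∣ * x + y * suc ∣ ∁ S ∣       ∎
  where open ≡-Reasoning

sum-weight : ∀ {m} (S : Subset m) x y → sum (weight S x y) ≡ ∣ S ∣ * x + y * (m ∸ ∣ S ∣)
sum-weight S x y =
  trans (sum-weight-∁ S x y) (cong (λ c → ∣ S ∣ * x + y * c) (∣∁p∣≡n∸∣p∣ S))

-- Greedy choice of disjoint subsets

-- Only the last set may be small: it makes its choice first.
disjointSubsets : ∀ {n k} (d : Vector ℕ (suc k)) (L : Vector (Subset n) (suc k)) →
  (∀ i → sum d ≤ ∣ L i ∣ ⊎ (i ≡ fromℕ k × d i ≤ ∣ L i ∣)) →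
  ∃ λ (P : Vector (Subset n) (suc k)) → ∃ λ U →
    (∀ i → P i ⊆ L i) × (∀ i → ∣ P i ∣ ≡ d i) ×
    (∀ {i j x} → x ∈ P i → x ∈ P j → i ≡ j) ×
    (∀ i → P i ⊆ U) × ∣ U ∣ ≤ sum d
disjointSubsets {k = zero} d L large =
  let Q , Q⊆L , ∣Q∣≡d = ⊆-choose (L zero)
        ([ ≤-trans (m≤m+n _ _) , proj₂ ]′ (large zero))
  in (λ _ → Q) , Q
   , (λ { zero → Q⊆L })
   , (λ { zero → ∣Q∣≡d })
   , (λ { {zero} {zero} _ _ → refl })
   , (λ _ → id)
   , ≤-trans (≤-reflexive ∣Q∣≡d) (m≤m+n _ _)
disjointSubsets {n} {suc k} d L large
  with disjointSubsets (d ∘ suc) (L ∘ suc) (λ i →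
         [ (λ Σ≤ → inj₁ (≤-trans (m≤n+m _ (d zero)) Σ≤))
         , (λ { (eq , d≤) → inj₂ (suc-injective eq , d≤) }) ]′ (large (suc i)))
     | large zero
... | P , U , P⊆L , ∣P∣≡d , disj , P⊆U , ∣U∣≤ | inj₁ Σd≤ =
  -- `U` collects all points used so far, at most `sum (d ∘ suc)` of them, so a set of size at least
  -- `sum d` still has `d zero` points outside `U`.
  let Q , Q⊆ , ∣Q∣≡d = ⊆-choose (L zero ─ U)
        (+-cancelʳ-≤ (sum (d ∘ suc)) _ _ (≤-trans Σd≤
          (≤-trans (∣p∣≤∣p─q∣+∣q∣ (L zero) U) (+-monoʳ-≤ ∣ L zero ─ U ∣ ∣U∣≤))))
      Q∩P=∅ : ∀ {i x} → x ∈ Q → x ∉ P i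
      Q∩P=∅ {i} x∈Q x∈P = p─q-disjoint-q (L zero) U (Q⊆ x∈Q) (P⊆U i x∈P)
  in (λ { zero → Q ; (suc i) → P i }) , Q ∪ U
   , (λ { zero → p─q⊆p (L zero) U ∘ Q⊆ ; (suc i) → P⊆L i })
   , (λ { zero → ∣Q∣≡d ; (suc i) → ∣P∣≡d i })
   , (λ { {zero} {zero} _ _ → refl
        ; {zero} {suc j} x∈Q x∈P → contradiction x∈P (Q∩P=∅ x∈Q)
        ; {suc i} {zero} x∈P x∈Q → contradiction x∈P (Q∩P=∅ x∈Q)
        ; {suc i} {suc j} x∈ x∈′ → cong suc (disj x∈ x∈′) })
   , (λ { zero → p⊆p∪q U ; (suc i) → q⊆p∪q Q U ∘ P⊆U i })
   , ≤-trans (∣p∪q∣≤∣p∣+∣q∣ Q U) (+-mono-≤ (≤-reflexive ∣Q∣≡d) ∣U∣≤)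

-- Degrees and edge counts

module _ {m n : ℕ} (G : BipartiteGraph m n) where

  neighbours : Fin m → Subset n
  neighbours a = Vec.tabulate (G a)

  degᴬ≡∣neighbours∣ : ∀ a → degᴬ G a ≡ ∣ neighbours a ∣
  degᴬ≡∣neighbours∣ a = length-filterᵇ-tabulate (G a) id

  degᴬ≤n : ∀ a → degᴬ G a ≤ n
  degᴬ≤n a = ≤-trans (≤-reflexive (degᴬ≡∣neighbours∣ a)) (∣p∣≤n (neighbours a))

  degᴬ≡n⇒full : ∀ {a} → degᴬ G a ≡ n → ∀ b → G a b ≡ true
  degᴬ≡n⇒full {a} deg≡n b = ∈-tabulate⁻ (G a) (subst (b ∈_)
    (sym (∣p∣≡n⇒p≡⊤ (trans (sym (degᴬ≡∣neighbours∣ a)) deg≡n))) ∈⊤)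

  full⇒degᴬ≡n : ∀ {a} → (∀ b → G a b ≡ true) → degᴬ G a ≡ n
  full⇒degᴬ≡n {a} full = trans (degᴬ≡∣neighbours∣ a) (≤-antisym (∣p∣≤n (neighbours a))
    (≤-trans (≤-reflexive (sym (∣⊤∣≡n n))) (p⊆q⇒∣p∣≤∣q∣ {p = ⊤} (λ {b} _ → ∈-tabulate⁺ (G a) (full b)))))

  e≡sum-degᴬ : e G ≡ sum (degᴬ G)
  e≡sum-degᴬ = rows id
    where
    -- `allFin m` is `tabulate id`; an arbitrary `f` in place of `id` lets the induction pass to the
    -- tail.
    rows : ∀ {l} (f : Fin l → Fin m) →
      length (filterᵇ (uncurry G) (cartesianProduct (tabulate f) (allFin n))) ≡ sum (degᴬ G ∘ f)
    rows {zero}  f = refl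
    rows {suc l} f = begin
      length (filterᵇ (uncurry G) (row ++ rest))
        ≡⟨ cong length (filter-++ (T? ∘ uncurry G) row rest) ⟩
      length (filterᵇ (uncurry G) row ++ filterᵇ (uncurry G) rest)
        ≡⟨ length-++ (filterᵇ (uncurry G) row) ⟩
      length (filterᵇ (uncurry G) row) + length (filterᵇ (uncurry G) rest)
        ≡⟨ cong₂ _+_ (length-filterᵇ-map (uncurry G) (f zero ,_) (allFin n)) (rows (f ∘ suc)) ⟩
      degᴬ G (f zero) + sum (degᴬ G ∘ f ∘ suc) ∎
      where
      open ≡-Reasoning
      row  = map (f zero ,_) (allFin n)
      rest = cartesianProduct (tabulate (f ∘ suc)) (allFin n)

  -- Embedding the forest with centres in A

  -- Star `i` gets centre `c i` and an enumeration of `P i` as its leaves. A shared leaf would lie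
  -- in two of the sets, so disjointness identifies the star before injectivity of the enumeration
  -- identifies the leaf.
  copy : ∀ {k} {d : Vector ℕ k} (c : Vector (Fin m) k) → Injective _≡_ _≡_ c →
    (P : Vector (Subset n) k) → (∀ i → P i ⊆ neighbours (c i)) → (∀ i → ∣ P i ∣ ≡ d i) →
    (∀ {i j x} → x ∈ P i → x ∈ P j → i ≡ j) →
    Copy (starForest d) (toGraph G)
  copy {k} {d} c c-inj P P⊆N ∣P∣≡d disj = mk↣ {to = f} f-inj , adj
    where
    leaf : ∀ i → Fin (d i) → Fin n
    leaf i = proj₁ (enumerate (P i) (∣P∣≡d i))
    leaf-inj : ∀ i → Injective _≡_ _≡_ (leaf i)
    leaf-inj i = proj₁ (proj₂ (enumerate (P i) (∣P∣≡d i)))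
    leaf-∈ : ∀ i j → leaf i j ∈ P i
    leaf-∈ i = proj₂ (proj₂ (enumerate (P i) (∣P∣≡d i)))
    f : Σ (Fin k) (λ i → Fin (suc (d i))) → Fin m ⊎ Fin n
    f (i , zero)  = inj₁ (c i)
    f (i , suc j) = inj₂ (leaf i j)
    f-inj : Injective _≡_ _≡_ f
    f-inj {i , zero}  {i′ , zero}   eq with refl ← c-inj (inj₁-injective eq) = refl
    f-inj {i , suc j} {i′ , suc j′} eq
      with leq ← inj₂-injective eq
      with refl ← disj {i} {i′} (leaf-∈ i j) (subst (_∈ P i′) (sym leq) (leaf-∈ i′ j′))
      = cong (λ l → i , suc l) (leaf-inj i leq)
    edge : ∀ i j → T (G (c i) (leaf i j))
    edge i j = Equivalence.from T-≡ (∈-tabulate⁻ (G (c i)) (P⊆N i (leaf-∈ i j)))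
    adj : ∀ {x y} → Graph._~_ (starForest d) x y → BipAdj G (f x) (f y)
    adj (within i (centre-leaf j)) = edge i j
    adj (within i (leaf-centre j)) = edge i j

  -- The side of `v` is given by an equation because `v` will be the image of a star vertex under a
  -- copy, which cannot be matched on.
  neighbourOfA : ∀ {v w a} → v ≡ inj₁ a → BipAdj G v w → ∃ λ b → w ≡ inj₂ b × T (G a b)
  neighbourOfA {w = inj₂ b} refl edge = b , refl , edge

  neighbourOfB : ∀ {v w b} → v ≡ inj₂ b → BipAdj G v w → ∃ λ a → w ≡ inj₁ a × T (G a b)
  neighbourOfB {w = inj₁ a} refl edge = a , refl , edge

  module _ {k} (s : Vector (Fin m) k) (a : Fin m) where

    private
      -- The last star is centred at `a`, the others at the vertices `s i`.
      place : ∀ {i : Fin (suc k)} → View i → Fin m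
      place ‵fromℕ       = a
      place (‵inject₁ i) = s i

      place-injective : Injective _≡_ _≡_ s → (∀ i → s i ≢ a) →
        ∀ {i j : Fin (suc k)} (u : View i) (v : View j) → place u ≡ place v → i ≡ j
      place-injective s-inj s≢a ‵fromℕ       ‵fromℕ       eq = refl
      place-injective s-inj s≢a ‵fromℕ       (‵inject₁ j) eq = contradiction (sym eq) (s≢a j)
      place-injective s-inj s≢a (‵inject₁ i) ‵fromℕ       eq = contradiction eq (s≢a i)
      place-injective s-inj s≢a (‵inject₁ i) (‵inject₁ j) eq = cong inject₁ (s-inj eq)

      place-large : {d : Vector ℕ (suc k)} →
        (∀ i → sum d ≤ ∣ neighbours (s i) ∣) → last d ≤ ∣ neighbours a ∣ →
        ∀ {i : Fin (suc k)} (v : View i) →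
        sum d ≤ ∣ neighbours (place v) ∣ ⊎ (i ≡ fromℕ k × d i ≤ ∣ neighbours (place v) ∣)
      place-large s-large a-large ‵fromℕ       = inj₂ (refl , a-large)
      place-large s-large a-large (‵inject₁ i) = inj₁ (s-large i)

    greedyCopy : {d : Vector ℕ (suc k)} → Injective _≡_ _≡_ s → (∀ i → s i ≢ a) →
      (∀ i → sum d ≤ ∣ neighbours (s i) ∣) → last d ≤ ∣ neighbours a ∣ →
      Copy (starForest d) (toGraph G)
    greedyCopy {d} s-inj s≢a s-large a-large =
      let P , _ , P⊆L , ∣P∣≡d , disj , _ =
            disjointSubsets d (λ i → neighbours (place (view i)))
              (λ i → place-large s-large a-large (view i))
      in copy (λ i → place (view i)) (λ {i} {j} → place-injective s-inj s≢a (view i) (view j))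
           P P⊆L ∣P∣≡d disj

  -- Otherwise `a` could carry the last star and the vertices of `S` the others, which is a greedy
  -- copy of the forest.
  free⇒degᴬ<last : ∀ {k} {d : Vector ℕ (suc k)} → starForest d -free toGraph G →
    (S : Subset m) → ∣ S ∣ ≡ k → (∀ a → a ∈ S → sum d ≤ degᴬ G a) →
    ∀ a → a ∉ S → degᴬ G a < last d
  free⇒degᴬ<last {d = d} free S ∣S∣≡k S-large a a∉S with degᴬ G a <? last d
  ... | yes deg<      = deg<
  ... | no  deg≮ =
    let s , s-inj , s∈S = enumerate S ∣S∣≡k
    in contradiction (greedyCopy s a s-inj
         (λ i s≡a → a∉S (subst (_∈ S) s≡a (s∈S i)))
         (λ i → ≤-trans (S-large (s i) (s∈S i)) (≤-reflexive (degᴬ≡∣neighbours∣ (s i))))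
         (≤-trans (≮⇒≥ deg≮) (≤-reflexive (degᴬ≡∣neighbours∣ a)))) free

  -- Upper bound and equality case

  large : ℕ → Subset m
  large D = Vec.tabulate (λ a → D ≤ᵇ degᴬ G a)

  ∈-large⁻ : ∀ {D a} → a ∈ large D → D ≤ degᴬ G a
  ∈-large⁻ {D} a∈ = ≤ᵇ⇒≤ D _ (Equivalence.from T-≡ (∈-tabulate⁻ _ a∈))

  ∉-large⁻ : ∀ {D a} → a ∉ large D → degᴬ G a < D
  ∉-large⁻ {D} {a} a∉ = ≰⇒> (λ D≤ → a∉ (∈-tabulate⁺ _ (Equivalence.to T-≡ (≤⇒≤ᵇ D≤))))

  -- Each large vertex contributes at most `n`, and all the others together at most `m * D`, which
  -- is less than one further `n`.
  few-large⇒e< : ∀ {k D} → m * D < n → ∣ large D ∣ < k → e G < k * n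
  few-large⇒e< {k} {D} mD<n few = begin-strict
    e G                                      ≡⟨ e≡sum-degᴬ ⟩
    sum (degᴬ G)                             ≤⟨ sum-mono-≤ deg≤ ⟩
    sum (weight B n D)                       ≡⟨ sum-weight B n D ⟩
    ∣ B ∣ * n + D * (m ∸ ∣ B ∣)              ≤⟨ +-monoʳ-≤ (∣ B ∣ * n) (*-monoʳ-≤ D (m∸n≤m m ∣ B ∣)) ⟩
    ∣ B ∣ * n + D * m                        ≡⟨ cong (∣ B ∣ * n +_) (*-comm D m) ⟩
    ∣ B ∣ * n + m * D                        <⟨ +-monoʳ-< (∣ B ∣ * n) mD<n ⟩
    ∣ B ∣ * n + n                            ≡⟨ +-comm _ n ⟩
    suc ∣ B ∣ * n                            ≤⟨ *-monoˡ-≤ n few ⟩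
    k * n                                    ∎
    where
    open ≤-Reasoning
    B = large D
    deg≤ : ∀ a → degᴬ G a ≤ weight B n D a
    deg≤ = ≤-weight B n D (λ a _ → degᴬ≤n a) (λ a a∉ → <⇒≤ (∉-large⁻ a∉))

  -- The dichotomy behind both the bound and its equality case: either there are fewer than `k`
  -- large vertices, or `k` of them serve as `S` and freeness caps all other degrees.
  free⇒e<⊎degᴬ≤weight : ∀ {k} {d : Vector ℕ (suc k)} → m * sum d < n →
    starForest d -free toGraph G →
    e G < k * n ⊎ ∃ λ S → ∣ S ∣ ≡ k × (∀ a → degᴬ G a ≤ weight S n (last d ∸ 1) a)
  free⇒e<⊎degᴬ≤weight {k} {d} mΣ<n free with k ≤? ∣ large (sum d) ∣
  ... | no  k≰ = inj₁ (few-large⇒e< mΣ<n (≰⇒> k≰))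
  ... | yes k≤ =
    let S , S⊆ , ∣S∣≡k = ⊆-choose (large (sum d)) k≤
    in inj₂ (S , ∣S∣≡k , ≤-weight S n (last d ∸ 1) (λ a _ → degᴬ≤n a)
         (λ a a∉S → <⇒≤pred (free⇒degᴬ<last free S ∣S∣≡k (λ a a∈S → ∈-large⁻ (S⊆ a∈S)) a a∉S)))

  free⇒e≤ : ∀ {k} {d : Vector ℕ (suc k)} → m * sum d < n → starForest d -free toGraph G →
    e G ≤ k * n + (last d ∸ 1) * (m ∸ k)
  free⇒e≤ {k} {d} mΣ<n free with free⇒e<⊎degᴬ≤weight mΣ<n free
  ... | inj₁ e<              = ≤-trans (<⇒≤ e<) (m≤m+n _ _)
  ... | inj₂ (S , refl , deg≤) = begin
    e G                                    ≡⟨ e≡sum-degᴬ ⟩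
    sum (degᴬ G)                           ≤⟨ sum-mono-≤ deg≤ ⟩
    sum (weight S n (last d ∸ 1))          ≡⟨ sum-weight S n (last d ∸ 1) ⟩
    ∣ S ∣ * n + (last d ∸ 1) * (m ∸ ∣ S ∣) ∎
    where open ≤-Reasoning

  -- Attaining the bound excludes the strict alternative and forces equality in every degree bound;
  -- a vertex of degree `n` is then full.
  extremal⇒𝓑 : ∀ {k} {d : Vector ℕ (suc k)} → m * sum d < n → starForest d -free toGraph G →
    k * n + (last d ∸ 1) * (m ∸ k) ≤ e G → Is𝓑 (suc k) (last d) G
  extremal⇒𝓑 {k} {d} mΣ<n free e≥ with free⇒e<⊎degᴬ≤weight mΣ<n free
  ... | inj₁ e<                = contradiction (≤-trans (m≤m+n _ _) e≥) (<⇒≱ e<)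
  ... | inj₂ (S , refl , deg≤) =
    S , refl
    , (λ a a∈S → degᴬ≡n⇒full (trans (deg≗ a) (weight-∈ S n (last d ∸ 1) a∈S)))
    , (λ a a∉S → trans (deg≗ a) (weight-∉ S n (last d ∸ 1) a∉S))
    where
    deg≗ : degᴬ G ≗ weight S n (last d ∸ 1)
    deg≗ = ≤∧sum-≥⇒≗ deg≤ (begin
      sum (weight S n (last d ∸ 1))          ≡⟨ sum-weight S n (last d ∸ 1) ⟩
      ∣ S ∣ * n + (last d ∸ 1) * (m ∸ ∣ S ∣) ≤⟨ e≥ ⟩
      e G                                    ≡⟨ e≡sum-degᴬ ⟩
      sum (degᴬ G)                           ∎)
      where open ≤-Reasoning

-- The extremal graph

-- lo ≤ b is written lo < suc b, which unlike lo ≤ᵇ b reduces along with b < lo + q.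
inInterval : ℕ → ℕ → ℕ → Bool
inInterval lo q b = (lo <ᵇ suc b) ∧ (b <ᵇ lo + q)

inInterval⁻ : ∀ {lo q b} → T (inInterval lo q b) → lo ≤ b × b < lo + q
inInterval⁻ {lo} {q} {b} t =
  let t₁ , t₂ = Equivalence.to T-∧ t
  in m<1+n⇒m≤n (<ᵇ⇒< lo (suc b) t₁) , <ᵇ⇒< b (lo + q) t₂

-- Dropping the first point lowers `lo`, or `q` once `lo` is zero, and the membership test reduces
-- in step.
∣interval∣ : ∀ lo q {n} → lo + q ≤ n → ∣ Vec.tabulate {n = n} (inInterval lo q ∘ toℕ) ∣ ≡ q
∣interval∣ zero     zero    {zero}  _        = refl
∣interval∣ zero     zero    {suc n} _        = ∣interval∣ zero zero {n} z≤n
∣interval∣ zero     (suc q) {suc n} (s≤s q≤) = cong suc (∣interval∣ zero q q≤)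
∣interval∣ (suc lo) q       {suc n} (s≤s ≤n) = ∣interval∣ lo q ≤n

-- Pigeonhole on the offsets `f j ∸ lo`, which lie below `q`; the subtraction is injective because
-- no value lies below `lo`.
injective⇒≤interval : ∀ {lo q r} (f : Fin r → ℕ) → Injective _≡_ _≡_ f →
  (∀ j → T (inInterval lo q (f j))) → r ≤ q
injective⇒≤interval {lo} {q} {r} f f-inj f∈ = ≮⇒≥ λ q<r →
  let i , j , i<j , eq = pigeonhole q<r (λ j → fromℕ< (offset<q j))
  in <⇒≢ i<j (f-inj (∸-cancelʳ-≡ (lo≤f i) (lo≤f j)
       (fromℕ<-injective _ _ (offset<q i) (offset<q j) eq)))
  where
  lo≤f : ∀ j → lo ≤ f j
  lo≤f j = proj₁ (inInterval⁻ (f∈ j))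
  offset<q : ∀ j → f j ∸ lo < q
  offset<q j = +-cancelˡ-< lo _ q
    (≤-<-trans (≤-reflexive (m+[n∸m]≡n (lo≤f j))) (proj₂ (inInterval⁻ {lo} (f∈ j))))

-- The intervals are consecutive blocks of length `q`: from `q * a ≤ b < q * suc a′` follows
-- `a ≤ a′`, and the converse by symmetry.
interval-unique : ∀ q {a a′ b} → T (inInterval (q * a) q b) → T (inInterval (q * a′) q b) → a ≡ a′
interval-unique q t t′ = ≤-antisym (below t t′) (below t′ t)
  where
  below : ∀ {a a′ b} → T (inInterval (q * a) q b) → T (inInterval (q * a′) q b) → a ≤ a′
  below {a} {a′} {b} t t′ = m<1+n⇒m≤n (*-cancelˡ-< q a (suc a′) (begin-strict
    q * a       ≤⟨ proj₁ (inInterval⁻ {q * a} {q} t) ⟩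
    b           <⟨ proj₂ (inInterval⁻ {q * a′} {q} t′) ⟩
    q * a′ + q  ≡⟨ +-comm _ q ⟩
    q + q * a′  ≡⟨ sym (*-suc q a′) ⟩
    q * suc a′  ∎))
    where open ≤-Reasoning

-- The first `k` vertices of A are full. Block positions depend on `toℕ a` alone, full or not, so
-- `m` blocks fit into B once `q * m ≤ n`.
extremal : ∀ m n (k q : ℕ) → BipartiteGraph m n
extremal m n k q a b = (toℕ a <ᵇ k) ∨ inInterval (q * toℕ a) q (toℕ b)

module _ {m n : ℕ} (k q : ℕ) where

  private
    E = extremal m n k q

  extremal-edge⁻ : ∀ {a b} → T (E a b) → toℕ a < k ⊎ T (inInterval (q * toℕ a) q (toℕ b))
  extremal-edge⁻ {a} t with Equivalence.to T-∨ t
  ... | inj₁ a<k = inj₁ (<ᵇ⇒< (toℕ a) k a<k)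
  ... | inj₂ b∈  = inj₂ b∈

  degᴬ-extremal : q * m ≤ n → ∀ a →
    degᴬ E a ≡ weight (Vec.tabulate (inInterval 0 k ∘ toℕ)) n q a
  degᴬ-extremal qm≤n a =
    trans (degree (toℕ a <ᵇ k) refl)
          (cong (if_then n else q) (sym (lookup∘tabulate (inInterval 0 k ∘ toℕ) a)))
    where
    open ≤-Reasoning
    E≡ : ∀ {full} → (toℕ a <ᵇ k) ≡ full → ∀ b → E a b ≡ full ∨ inInterval (q * toℕ a) q (toℕ b)
    E≡ eq b = cong (_∨ inInterval (q * toℕ a) q (toℕ b)) eq
    degree : ∀ full → (toℕ a <ᵇ k) ≡ full → degᴬ E a ≡ (if full then n else q)
    degree true  eq = full⇒degᴬ≡n E (E≡ eq)
    degree false eq = trans (degᴬ≡∣neighbours∣ E a) (trans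
      (cong ∣_∣ (tabulate-cong (E≡ eq)))
      (∣interval∣ (q * toℕ a) q (begin
        q * toℕ a + q    ≡⟨ +-comm _ q ⟩
        q + q * toℕ a    ≡⟨ sym (*-suc q _) ⟩
        q * suc (toℕ a)  ≤⟨ *-monoʳ-≤ q (toℕ<n a) ⟩
        q * m            ≤⟨ qm≤n ⟩
        n                ∎)))

  e-extremal : k ≤ m → q * m ≤ n → e E ≡ k * n + q * (m ∸ k)
  e-extremal k≤m qm≤n = begin
    e E                              ≡⟨ e≡sum-degᴬ E ⟩
    sum (degᴬ E)                     ≡⟨ sum-cong-≗ (degᴬ-extremal qm≤n) ⟩
    sum (weight S n q)               ≡⟨ sum-weight S n q ⟩
    ∣ S ∣ * n + q * (m ∸ ∣ S ∣)      ≡⟨ cong (λ c → c * n + q * (m ∸ c)) (∣interval∣ 0 k k≤m) ⟩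
    k * n + q * (m ∸ k)              ∎
    where
    open ≡-Reasoning
    S : Subset m
    S = Vec.tabulate (inInterval 0 k ∘ toℕ)

  -- Freeness of the construction

  -- Each of the `suc k` stars would contain one of the `k` full vertices, so two disjoint stars
  -- would share one.
  extremal-free : (d : Vector ℕ (suc k)) → (∀ i → q < d i) → starForest d -free toGraph E
  extremal-free d q<d (f , adj) =
    let i , j , i<j , eq = pigeonhole ≤-refl index
    in <⇒≢ i<j (index-injective eq)
    where
    open Injection f using (to; injective)

    MeetsFull : Fin (suc k) → Set
    MeetsFull i = ∃ λ v → ∃ λ a → to (i , v) ≡ inj₁ a × toℕ a < k

    -- A centre in A that is not full has its neighbours in a block of length `q`, too short for the
    -- `d i` leaves.
    centreInA : ∀ i {a} → to (i , zero) ≡ inj₁ a → MeetsFull i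
    centreInA i {a} to≡a with toℕ a <? k
    ... | yes a<k = zero , a , to≡a , a<k
    ... | no  a≮k = contradiction (injective⇒≤interval {q * toℕ a} (toℕ ∘ leaf) leaf-inj leaf-∈) (<⇒≱ (q<d i))
      where
      leafEdge : ∀ j → ∃ λ b → to (i , suc j) ≡ inj₂ b × T (E a b)
      leafEdge j = neighbourOfA E to≡a (adj (within i (centre-leaf j)))
      leaf : Fin (d i) → Fin n
      leaf j = proj₁ (leafEdge j)
      leaf-inj : Injective _≡_ _≡_ (toℕ ∘ leaf)
      leaf-inj {j} {j′} eq with refl ← injective (trans (proj₁ (proj₂ (leafEdge j)))
        (trans (cong inj₂ (toℕ-injective eq)) (sym (proj₁ (proj₂ (leafEdge j′)))))) = refl
      leaf-∈ : ∀ j → T (inInterval (q * toℕ a) q (toℕ (leaf j)))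
      leaf-∈ j = [ (λ a<k → contradiction a<k a≮k) , id ]′
        (extremal-edge⁻ (proj₂ (proj₂ (leafEdge j))))

    -- A vertex of B has at most one neighbour outside the full vertices, and
    -- none if q = 0, so some leaf of a star with more than q leaves is full.
    centreInB : ∀ i {b} → to (i , zero) ≡ inj₂ b → MeetsFull i
    centreInB i {b} to≡b =
      -- Leaves 0 and 1 suffice: if both are outside the full vertices they coincide. Leaf 1 exists
      -- because leaf 0 being outside makes its block nonempty, whence `q ≥ 1`.
      [ id , (λ t₀ → [ id , (λ t₁ → contradiction (leaf-unique t₀ t₁) (0≢1 (1<d t₀))) ]′
                       (meets (fromℕ< (1<d t₀)))) ]′ (meets (fromℕ< 0<d))
      where
      Outside : Fin (d i) → Set
      Outside j = ∃ λ a → to (i , suc j) ≡ inj₁ a × T (inInterval (q * toℕ a) q (toℕ b))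
      meets : ∀ j → MeetsFull i ⊎ Outside j
      meets j =
        let a , to≡a , t = neighbourOfB E to≡b (adj (within i (centre-leaf j)))
        in [ (λ a<k → inj₁ (suc j , a , to≡a , a<k)) , (λ t′ → inj₂ (a , to≡a , t′)) ]′
             (extremal-edge⁻ t)
      0<d : 0 < d i
      0<d = ≤-<-trans z≤n (q<d i)
      1<d : ∀ {j} → Outside j → 1 < d i
      1<d (a , _ , t) = let lo≤b , b<hi = inInterval⁻ {q * toℕ a} {q} t in
        ≤-<-trans (+-cancelˡ-< (q * toℕ a) 0 q
          (≤-<-trans (≤-reflexive (+-identityʳ _)) (≤-<-trans lo≤b b<hi))) (q<d i)
      leaf-unique : ∀ {j j′} → Outside j → Outside j′ → j ≡ j′
      leaf-unique (a , to≡a , t) (a′ , to≡a′ , t′)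
        with refl ← injective (trans to≡a (trans
               (cong inj₁ (toℕ-injective (interval-unique q t t′))) (sym to≡a′))) = refl
      0≢1 : (1<d′ : 1 < d i) → fromℕ< 0<d ≢ fromℕ< 1<d′
      0≢1 1<d′ eq with () ← fromℕ<-injective 0 1 0<d 1<d′ eq

    meetsFull : ∀ i → MeetsFull i
    meetsFull i with to (i , zero) in to≡
    ... | inj₁ a = centreInA i to≡
    ... | inj₂ b = centreInB i to≡

    index : Fin (suc k) → Fin k
    index i = let _ , a , _ , a<k = meetsFull i in fromℕ< a<k

    index-injective : ∀ {i j} → index i ≡ index j → i ≡ j
    index-injective {i} {j} eq =
      let _ , a , to≡ , a<k = meetsFull i
          _ , a′ , to≡′ , a′<k = meetsFull j
          a≡a′ = toℕ-injective (fromℕ<-injective _ _ a<k a′<k eq)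
      in cong proj₁ (injective (trans to≡ (trans (cong inj₁ a≡a′) (sym to≡′))))

-- Combining the bounds for large `n`

theorem1p6 : (k-1 : ℕ) (d : Vector ℕ (suc k-1)) →
    d Preserves _≤ᶠ_ ⟶ _≥_ →
    last d ≥ 1 →
    (m : ℕ) → m ≥ 1 → m ≥ k-1 →
    ∃ λ (n₀ : ℕ) → (n : ℕ) → n ≥ n₀ →
    IsEx m n (starForest d) (k-1 * n + (last d ∸ 1) * (m ∸ k-1))
    × ((G : BipartiteGraph m n) →
    starForest d -free toGraph G →
    IsEx m n (starForest d) (e G) →
    Is𝓑 (suc k-1) (last d) G)
-- The threshold gives `m * sum d < n`, which the upper bound needs strictly; it also leaves room
-- for the `m` blocks, since `q ≤ sum d`.
theorem1p6 k d d-mono last≥1 m _ k≤m = suc (m * sum d) , λ n n≥n₀ →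
  let q = last d ∸ 1
      q<d : ∀ i → q < d i
      -- As `last d ≥ 1`, the truncated subtraction is exact and `suc q` equals `last d`, the least
      -- of the sizes.
      q<d i = ≤-trans (≤-reflexive (m+[n∸m]≡n last≥1)) (d-mono (≤fromℕ i))
      qm≤n : q * m ≤ n
      qm≤n = ≤-trans (*-monoˡ-≤ m (≤-trans (m∸n≤m _ 1) (lookup≤sum d (fromℕ k))))
               (≤-trans (≤-reflexive (*-comm (sum d) m)) (<⇒≤ n≥n₀))
      E-free = extremal-free k q d q<d
      e≡     = e-extremal k q k≤m qm≤n
  in ((extremal m n k q , E-free , e≡) , λ G → free⇒e≤ G n≥n₀)
   , λ G free (_ , maximal) →
       -- Maximality of `G` is tested against the construction, so `e G` reaches the bound.
       extremal⇒𝓑 G n≥n₀ free (≤-trans (≤-reflexive (sym e≡)) (maximal _ E-free))
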